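{- For every positive integer $d$ there exists $n$ with the following property: for every linear ordering $\prec$ of $[2]^n$ there is a $d$-subcube $C$ of $[2]^n$ such that the restriction of $\prec$ to $C$ (viewed, via the canonical bijection, as a linear ordering of $[2]^d$) is the lexicographic ordering on $[2]^d$ induced by one of the two linear orderings of $[2]$.
   Context: Elements of $[k]^n$ ($[k]=\{1,\dotsc,k\}$) are words of length $n$ over the alphabet $[k]$. A $d$-parameter word of length $n$ is a word $p$ of length $n$ over the alphabet $[k]\cup\{*_1,\dotsc,*_d\}$ containing each of $*_1,\dotsc,*_d$ at least once. For a word $w=w_1\dotsb w_d$, $p[w]$ denotes the word obtained from $p$ by replacing every occurrence of $*_i$ by $w_i$ for each $i$. The set $\{p[w]: w\in[k]^d\}$ is called a $d$-subcube of $[k]^n$. A $d$-parameter word is canonical if the first occurrence of $*_1$ precedes the first occurrence of $*_2$, which precedes the first occurrence of $*_3$, etc. Every $d$-subcube is induced by a unique canonical word $p$, and $w\mapsto p[w]$ is the canonical bijection between $[k]^d$ and the subcube. The restriction of a linear ordering $\prec$ of $[k]^n$ to the subcube is the linear ordering of $[k]^d$ given by $w\prec w'$ iff $p[w]\prec p[w']$. Given a linear ordering $<$ of $[k]$, the lexicographic ordering $<_{\mathrm{lex}}$ on $[k]^d$ is defined by $w<_{\mathrm{lex}}w'$ iff $w_i<w'_i$ where $i$ is the least index with $w_i\ne w'_i$. -}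

module Defs where

open import Level using (0ℓ)
open import Data.Nat using (ℕ)
open import Data.Fin using (Fin) renaming (_<_ to _<ᶠ_)
open import Data.Vec using (Vec; lookup; map)
open import Data.Sum using (_⊎_; inj₁; inj₂)
open import Data.Product using (Σ; _×_; ∃)
open import Relation.Binary using (Rel)
open import Relation.Binary.PropositionalEquality using (_≡_; _≢_)

Word : ℕ → ℕ → Set
Word k n = Vec (Fin k) n

-- Letters of a d-parameter word: inj₁ a is the letter a ∈ [k], inj₂ i is the wildcard *_i.
ParamWord : ℕ → ℕ → ℕ → Set
ParamWord k d n = Vec (Fin k ⊎ Fin d) n

IsParamWord : ∀ {k d n} → ParamWord k d n → Set
IsParamWord {k} {d} {n} p = ∀ (i : Fin d) → ∃ λ (pos : Fin n) → lookup p pos ≡ inj₂ i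

IsFirstOcc : ∀ {k d n} → ParamWord k d n → Fin d → Fin n → Set
IsFirstOcc p i pos = (lookup p pos ≡ inj₂ i) × (∀ pos' → pos' <ᶠ pos → lookup p pos' ≢ inj₂ i)

IsCanonical : ∀ {k d n} → ParamWord k d n → Set
IsCanonical {k} {d} {n} p =
  ∀ (i j : Fin d) (pi pj : Fin n) → i <ᶠ j → IsFirstOcc p i pi → IsFirstOcc p j pj → pi <ᶠ pj

subst : ∀ {k d n} → ParamWord k d n → Word k d → Word k n
subst p w = map f p
  where
  f : _ → _
  f (inj₁ a) = a
  f (inj₂ i) = lookup w i

restrict : ∀ {k d n} → Rel (Word k n) 0ℓ → ParamWord k d n → Rel (Word k d) 0ℓ
restrict _≺_ p w w' = subst p w ≺ subst p w'

Lex : ∀ {k d} → Rel (Fin k) 0ℓ → Rel (Word k d) 0ℓ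
Lex {k} {d} _<_ w w' =
  ∃ λ (i : Fin d) → (∀ (j : Fin d) → j <ᶠ i → lookup w j ≡ lookup w' j) × (lookup w i < lookup w' i)

{-# OPTIONS --safe #-}
module Submission where

-- First pass to a subcube on which the order is monotone for inclusion, up to reversal. Colour each
-- word of a first group of coordinates by the whole order induced on its fibre; the pigeonhole
-- principle on the words 1⋯10⋯0 gives a line along which all later comparisons agree. Iterating, the
-- sign of an edge depends only on its direction, and one keeps the directions of a single sign.
--
-- In a monotone order, split the coordinates into blocks, let the first wildcard fill all blocks but
-- one block b, and put the other wildcards inside b. If the full block b lies below its complement,
-- monotonicity alone makes the first wildcard dominate the others; for each order at most one block
-- fails this. Recursing in b for several orders simultaneously gives a lexicographic subcube.

open import Defs
open import Level using (0ℓ)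
open import Data.Nat using (ℕ; zero; suc; _≤_; _+_; _*_; _^_; s≤s; z≤n; z<s; s<s)
import Data.Nat.Properties as ℕ
open import Data.Fin using
  ( Fin; zero; suc; toℕ; combine; _↑ˡ_; _↑ʳ_; splitAt; funToFin; finToFun
  ) renaming (_<_ to _<ᶠ_; _≤_ to _≤ᶠ_)
import Data.Fin.Properties as Fin
open import Data.Vec using (Vec; []; _∷_; _++_; lookup; map; concat; replicate; tabulate; _[_]≔_)
open import Data.Vec.Properties using
  ( lookup-map; map-∘; map-cong; map-concat; map-[]≔; map-replicate; map-++; lookup-concat
  ; lookup∘update; lookup∘update′; lookup-replicate; lookup-++ˡ; lookup-++ʳ; tabulate-cong
  ; tabulate∘lookup
  )
open import Data.Product using (Σ; _×_; ∃; _,_; proj₁; proj₂)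
open import Data.Sum using (_⊎_; inj₁; inj₂; [_,_]′; map₂)
open import Function using (_∘_; flip)
open import Function.Bundles using (_⇔_; mk⇔; Equivalence)
open import Relation.Binary using
  ( Rel; IsStrictTotalOrder; IsTotalOrder; IsDecTotalOrder; Transitive; Total; Decidable; Tri
  ; tri<; tri≈; tri>
  )
import Relation.Binary.Construct.Flip.EqAndOrd as Flip
import Relation.Binary.Construct.StrictToNonStrict as StrictToNonStrict
open import Relation.Binary.PropositionalEquality using
  ( _≡_; _≢_; _≗_; refl; sym; trans; cong; cong₂; subst₂; module ≡-Reasoning
  ) renaming (subst to transport)
open import Relation.Nullary using (Dec; ¬_; yes; no; contradiction)

private
  variable
    A : Set
    k d m n s t : ℕ

pattern 𝟎 = zero
pattern 𝟏 = suc zero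

-- Parameter words: substitution, composition and the order of wildcards

letter : Word k d → Fin k ⊎ Fin d → Fin k
letter w = [ (λ a → a) , lookup w ]′

-- The local function of `subst` is replaced by the named `letter`, so that the laws of `map` and
-- `lookup` apply to substitutions.
subst≡map : (p : ParamWord k d n) (w : Word k d) → subst p w ≡ map (letter w) p
subst≡map p w = map-cong (λ { (inj₁ a) → refl ; (inj₂ i) → refl }) p

lookup-subst : (p : ParamWord k d n) (w : Word k d) (i : Fin n) →
               lookup (subst p w) i ≡ letter w (lookup p i)
lookup-subst p w i = trans (cong (λ v → lookup v i) (subst≡map p w)) (lookup-map i (letter w) p)

infixr 9 _∘ₚ_
_∘ₚ_ : ParamWord k m n → ParamWord k d m → ParamWord k d n
q ∘ₚ p = map [ inj₁ , lookup p ]′ q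

subst-∘ₚ : (q : ParamWord k m n) (p : ParamWord k d m) (w : Word k d) →
           subst (q ∘ₚ p) w ≡ subst q (subst p w)
subst-∘ₚ q p w = begin
  subst (q ∘ₚ p) w                         ≡⟨ subst≡map (q ∘ₚ p) w ⟩
  map (letter w) (q ∘ₚ p)                  ≡⟨ map-∘ (letter w) [ inj₁ , lookup p ]′ q ⟨
  map (letter w ∘ [ inj₁ , lookup p ]′) q  ≡⟨ map-cong (λ { (inj₁ a) → refl ; (inj₂ i) → sym (lookup-subst p w i) }) q ⟩
  map (letter (subst p w)) q               ≡⟨ subst≡map q (subst p w) ⟨
  subst q (subst p w)                      ∎
  where open ≡-Reasoning

shift : ParamWord k d n → ParamWord k (suc d) n
shift = map (map₂ suc)

subst-shift : (q : ParamWord k d n) (a : Fin k) (w : Word k d) →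
              subst (shift q) (a ∷ w) ≡ subst q w
subst-shift q a w = begin
  subst (shift q) (a ∷ w)           ≡⟨ subst≡map (shift q) (a ∷ w) ⟩
  map (letter (a ∷ w)) (shift q)    ≡⟨ map-∘ (letter (a ∷ w)) (map₂ suc) q ⟨
  map (letter (a ∷ w) ∘ map₂ suc) q ≡⟨ map-cong (λ { (inj₁ b) → refl ; (inj₂ i) → refl }) q ⟩
  map (letter w) q                  ≡⟨ subst≡map q w ⟨
  subst q w                         ∎
  where open ≡-Reasoning

-- Unlike IsCanonical, this form passes to compositions without locating first occurrences.
Preceded : ParamWord k d n → Set
Preceded {d = d} {n = n} p =
  ∀ {i j : Fin d} (y : Fin n) → i <ᶠ j → lookup p y ≡ inj₂ j →
  ∃ λ (x : Fin n) → (x <ᶠ y) × lookup p x ≡ inj₂ i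

Ordered : ParamWord k d n → Set
Ordered p = IsParamWord p × Preceded p

-- The first occurrence of `i` is no later than the one that `Preceded` supplies before the first
-- occurrence of `j`.
preceded⇒canonical : (p : ParamWord k d n) → Preceded p → IsCanonical p
preceded⇒canonical p prec i j x y i<j (_ , x-first) (py≡j , _) with prec y i<j py≡j
... | z , z<y , pz≡i with Fin.<-cmp z x
...   | tri< z<x _ _ = contradiction pz≡i (x-first z z<x)
...   | tri≈ _ refl _ = z<y
...   | tri> _ _ x<z = Fin.<-trans x<z z<y

-- A wildcard of the composite comes from a wildcard of `q` whose index is a position in `p`.
-- Precedence in `p` yields a smaller index of `q`, and precedence in `q` then yields an earlier
-- position.
ordered-∘ₚ : (q : ParamWord k m n) (p : ParamWord k d m) → Ordered q → Ordered p → Ordered (q ∘ₚ p)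
ordered-∘ₚ q p (param-q , prec-q) (param-p , prec-p) = param , prec
  where
  lookup-∘ : ∀ {x i} → lookup q x ≡ inj₂ i → lookup (q ∘ₚ p) x ≡ lookup p i
  lookup-∘ {x} eq = trans (lookup-map x [ inj₁ , lookup p ]′ q) (cong [ inj₁ , lookup p ]′ eq)

  wildcard : ∀ x {j} → lookup (q ∘ₚ p) x ≡ inj₂ j → ∃ λ i → lookup q x ≡ inj₂ i × lookup p i ≡ inj₂ j
  wildcard x eq with lookup q x | trans (sym (lookup-map x [ inj₁ , lookup p ]′ q)) eq
  ... | inj₂ i | pi≡j = i , refl , pi≡j

  param : IsParamWord (q ∘ₚ p)
  param j with param-p j
  ... | i , pi≡j with param-q i
  ...   | x , qx≡i = x , trans (lookup-∘ qx≡i) pi≡j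

  prec : Preceded (q ∘ₚ p)
  prec y i<j eq with wildcard y eq
  ... | j′ , qy≡j′ , pj′≡j with prec-p j′ i<j pj′≡j
  ...   | i′ , i′<j′ , pi′≡i with prec-q y i′<j′ qy≡j′
  ...     | x , x<y , qx≡i′ = x , x<y , trans (lookup-∘ qx≡i′) pi′≡i

map₂-suc⁻¹ : {x : Fin k ⊎ Fin d} {i : Fin d} → map₂ suc x ≡ inj₂ (suc i) → x ≡ inj₂ i
map₂-suc⁻¹ {x = inj₂ _} refl = refl

-- The common pattern of `join`, `take` and `enclose`: a new first wildcard is put in front of a
-- copy of `q` embedded along `e`. Position `z` precedes the whole copy, and `located` confines the
-- old wildcards to it, so their precedence is inherited from `q`.
ordered-extend :
  (p : ParamWord k (suc d) n) (q : ParamWord k d m) (z : Fin n) (e : Fin m → Fin n) →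
  lookup p z ≡ inj₂ zero → (∀ i → z <ᶠ e i) → (∀ {i j} → i <ᶠ j → e i <ᶠ e j) →
  (∀ i → lookup p (e i) ≡ map₂ suc (lookup q i)) →
  (∀ x {i} → lookup p x ≡ inj₂ (suc i) → ∃ λ x′ → x ≡ e x′) →
  Ordered q → Ordered p
ordered-extend p q z e pz≡0 z<e e-mono pe≡q located (param-q , prec-q) = param , prec
  where
  param : IsParamWord p
  param zero = z , pz≡0
  param (suc i) with param-q i
  ... | x , qx≡i = e x , trans (pe≡q x) (cong (map₂ suc) qx≡i)

  prec : Preceded p
  prec {i} {suc j} y i<j py≡j with located y py≡j
  prec {zero}  {suc j} y i<j py≡j | y′ , refl = z , z<e y′ , pz≡0
  prec {suc i} {suc j} y (s<s i<j) py≡j | y′ , refl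
    with prec-q y′ i<j (map₂-suc⁻¹ (trans (sym (pe≡q y′)) py≡j))
  ... | x , x<y′ , qx≡i = e x , e-mono x<y′ , trans (pe≡q x) (cong (map₂ suc) qx≡i)

-- Constancy of edge directions

threshold : ∀ n → Fin (suc n) → Word 2 n
threshold n       zero    = replicate n 𝟎
threshold (suc n) (suc i) = 𝟏 ∷ threshold n i

interval : ∀ n → Fin (suc n) → Fin (suc n) → ParamWord 2 1 n
interval zero    _       _       = []
interval (suc n) zero    zero    = replicate (suc n) (inj₁ 𝟎)
interval (suc n) zero    (suc j) = inj₂ zero ∷ interval n zero j
-- A default value: the left index exceeds the right one here, and `interval` is evaluated only at
-- ordered indices.
interval (suc n) (suc i) zero    = replicate (suc n) (inj₁ 𝟎)
interval (suc n) (suc i) (suc j) = inj₁ 𝟏 ∷ interval n i j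

subst-interval : ∀ n {i j} → i ≤ᶠ j →
                 subst (interval n i j) (𝟎 ∷ []) ≡ threshold n i ×
                 subst (interval n i j) (𝟏 ∷ []) ≡ threshold n j
subst-interval n {i} {j} i≤j = trans (subst≡map _ _) (low n i j i≤j) , trans (subst≡map _ _) (high n i j i≤j)
  where
  low : ∀ n i j → i ≤ᶠ j → map (letter (𝟎 ∷ [])) (interval n i j) ≡ threshold n i
  low zero    zero    _       _ = refl
  low (suc n) zero    zero    _ = map-replicate _ _ (suc n)
  low (suc n) zero    (suc j) _ = cong (𝟎 ∷_) (low n zero j z≤n)
  low (suc n) (suc i) (suc j) (s≤s i≤j) = cong (𝟏 ∷_) (low n i j i≤j)

  high : ∀ n i j → i ≤ᶠ j → map (letter (𝟏 ∷ [])) (interval n i j) ≡ threshold n j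
  high zero    zero    zero    _ = refl
  high (suc n) zero    zero    _ = map-replicate _ _ (suc n)
  high (suc n) zero    (suc j) _ = cong (𝟏 ∷_) (high n zero j z≤n)
  high (suc n) (suc i) (suc j) (s≤s i≤j) = cong (𝟏 ∷_) (high n i j i≤j)

interval-wildcard : ∀ n {i j} → i <ᶠ j → ∃ λ x → lookup (interval n i j) x ≡ inj₂ zero
interval-wildcard (suc n) {zero}  {suc j} _ = zero , refl
interval-wildcard (suc n) {suc i} {suc j} (s<s i<j) with interval-wildcard n i<j
... | x , eq = suc x , eq

-- There are `n + 1` threshold words and only `n` colours, so two of them share a colour; the
-- interval between them is a line with these two ends.
monochromatic-line : (c : Word 2 n → Fin n) → Σ (ParamWord 2 1 n) λ ℓ →
  (∃ λ x → lookup ℓ x ≡ inj₂ zero) × c (subst ℓ (𝟎 ∷ [])) ≡ c (subst ℓ (𝟏 ∷ []))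
monochromatic-line {n} c with Fin.pigeonhole (ℕ.n<1+n n) (c ∘ threshold n)
... | i , j , i<j , eq with subst-interval n {i} {j} (ℕ.<⇒≤ i<j)
...   | low , high = interval n i j , interval-wildcard n i<j ,
                     trans (cong c low) (trans eq (cong c (sym high)))

decode : Fin (2 ^ n) → Word 2 n
decode x = tabulate (finToFun x)

decode-surjective : (w : Word 2 n) → decode (funToFin (lookup w)) ≡ w
decode-surjective w = trans (tabulate-cong (Fin.finToFun-funToFin (lookup w))) (tabulate∘lookup w)

-- Turns a whole colouring of a cube into a single colour, to which the pigeonhole principle can be
-- applied.
encode : (Word 2 n → Fin t) → Fin (t ^ (2 ^ n))
encode g = funToFin (g ∘ decode)

encode-injective : {g h : Word 2 n → Fin t} → encode g ≡ encode h → g ≗ h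
encode-injective {g = g} {h} eq w = transport (λ v → g v ≡ h v) (decode-surjective w) (begin
  g (decode x)          ≡⟨ Fin.finToFun-funToFin (g ∘ decode) x ⟨
  finToFun (encode g) x ≡⟨ cong (λ y → finToFun y x) eq ⟩
  finToFun (encode h) x ≡⟨ Fin.finToFun-funToFin (h ∘ decode) x ⟩
  h (decode x)          ∎)
  where
  open ≡-Reasoning
  x = funToFin (lookup w)

join : ParamWord 2 1 m → ParamWord 2 d n → ParamWord 2 (suc d) (m + n)
join ℓ q = map (map₂ (_↑ˡ _)) ℓ ++ shift q

subst-join : (ℓ : ParamWord 2 1 m) (q : ParamWord 2 d n) (a : Fin 2) (w : Word 2 d) →
             subst (join ℓ q) (a ∷ w) ≡ subst ℓ (a ∷ []) ++ subst q w
subst-join ℓ q a w = begin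
  subst (join ℓ q) (a ∷ w)
    ≡⟨ subst≡map (join ℓ q) (a ∷ w) ⟩
  map (letter (a ∷ w)) (map (map₂ (_↑ˡ _)) ℓ ++ shift q)
    ≡⟨ map-++ (letter (a ∷ w)) (map (map₂ (_↑ˡ _)) ℓ) (shift q) ⟩
  map (letter (a ∷ w)) (map (map₂ (_↑ˡ _)) ℓ) ++ map (letter (a ∷ w)) (shift q)
    ≡⟨ cong₂ _++_ left (trans (sym (subst≡map (shift q) (a ∷ w))) (subst-shift q a w)) ⟩
  subst ℓ (a ∷ []) ++ subst q w ∎
  where
  open ≡-Reasoning
  left : map (letter (a ∷ w)) (map (map₂ (_↑ˡ _)) ℓ) ≡ subst ℓ (a ∷ [])
  left = trans (sym (map-∘ (letter (a ∷ w)) (map₂ (_↑ˡ _)) ℓ))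
        (trans (map-cong (λ { (inj₁ b) → refl ; (inj₂ zero) → refl }) ℓ)
               (sym (subst≡map ℓ (a ∷ []))))

↑ˡ<↑ʳ : (i : Fin m) (j : Fin n) → i ↑ˡ n <ᶠ m ↑ʳ j
↑ˡ<↑ʳ {m} {n} i j = subst₂ Data.Nat._<_ (sym (Fin.toℕ-↑ˡ i n)) (sym (Fin.toℕ-↑ʳ m j))
  (ℕ.<-≤-trans (Fin.toℕ<n i) (ℕ.m≤m+n m (toℕ j)))

ordered-join : (ℓ : ParamWord 2 1 m) (q : ParamWord 2 d n) →
               (∃ λ x → lookup ℓ x ≡ inj₂ zero) → Ordered q → Ordered (join ℓ q)
ordered-join {m} {d} {n} ℓ q (z , ℓz≡0) = ordered-extend (join ℓ q) q (z ↑ˡ n) (m ↑ʳ_)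
  (trans (left z) (cong (map₂ (_↑ˡ d)) ℓz≡0)) (↑ˡ<↑ʳ z)
  (λ i<j → subst₂ Data.Nat._<_ (sym (Fin.toℕ-↑ʳ m _)) (sym (Fin.toℕ-↑ʳ m _)) (ℕ.+-monoʳ-< m i<j))
  (λ i → trans (lookup-++ʳ (map (map₂ (_↑ˡ d)) ℓ) (shift q) i) (lookup-map i (map₂ suc) q)) located
  where
  left : ∀ x → lookup (join ℓ q) (x ↑ˡ n) ≡ map₂ (_↑ˡ d) (lookup ℓ x)
  left x = trans (lookup-++ˡ (map (map₂ (_↑ˡ d)) ℓ) (shift q) x) (lookup-map x (map₂ (_↑ˡ d)) ℓ)

  located : ∀ x {i} → lookup (join ℓ q) x ≡ inj₂ (suc i) → ∃ λ x′ → x ≡ m ↑ʳ x′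
  located x eq with splitAt m x | Fin.join-splitAt m n x
  ... | inj₂ x′ | refl = x′ , refl
  ... | inj₁ x′ | refl with lookup ℓ x′ | trans (sym (left x′)) eq
  ...   | inj₁ _    | ()
  ...   | inj₂ zero | ()

-- The colouring c is carried along because r, seen along the direction chosen first, is a
-- colouring of the words in the remaining coordinates.
direction-constant : ∀ d t → ∃ λ n →
  (r : Word 2 n → Word 2 n → Fin 2) (c : Word 2 n → Fin t) →
  Σ (ParamWord 2 d n) λ p → Ordered p ×
    (∀ w w' → c (subst p w) ≡ c (subst p w')) ×
    Σ (Word 2 d) λ ε → ∀ w i → r (subst p (w [ i ]≔ 𝟎)) (subst p (w [ i ]≔ 𝟏)) ≡ lookup ε i
direction-constant zero    t = zero , λ r c → [] , ((λ ()) , λ { {()} }) , (λ { [] [] → refl }) , [] , λ _ ()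
direction-constant (suc d) t = M + N , cube
  where
  N = proj₁ (direction-constant d (t * 2))
  -- The number of possible profiles: for each of the `2 ^ N` words `v`, a colour out of `t` and a
  -- row of `2 ^ N` signs. A line needs as many coordinates as colours.
  M = (t * 2 ^ (2 ^ N)) ^ (2 ^ N)

  module _ (r : Word 2 (M + N) → Word 2 (M + N) → Fin 2) (c : Word 2 (M + N) → Fin t) where
    row : Word 2 M → Word 2 N → Word 2 N → Fin 2
    row u v v' = r (u ++ v) (u ++ v')

    profile : Word 2 M → Word 2 N → Fin (t * 2 ^ (2 ^ N))
    profile u v = combine (c (u ++ v)) (encode (row u v))

    cube : Σ (ParamWord 2 (suc d) (M + N)) λ p → Ordered p ×
      (∀ w w' → c (subst p w) ≡ c (subst p w')) ×
      Σ (Word 2 (suc d)) λ ε → ∀ w i → r (subst p (w [ i ]≔ 𝟎)) (subst p (w [ i ]≔ 𝟏)) ≡ lookup ε i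
    cube with monochromatic-line (encode ∘ profile)
    ... | ℓ , ℓ-wildcard , profile-eq = result
      where
      u : Fin 2 → Word 2 M
      u a = subst ℓ (a ∷ [])

      same-pair : ∀ v → c (u 𝟎 ++ v) ≡ c (u 𝟏 ++ v) × encode (row (u 𝟎) v) ≡ encode (row (u 𝟏) v)
      same-pair v = Fin.combine-injective (c (u 𝟎 ++ v)) (encode (row (u 𝟎) v)) (c (u 𝟏 ++ v)) (encode (row (u 𝟏) v))
        (encode-injective {g = profile (u 𝟎)} {h = profile (u 𝟏)} profile-eq v)

      same-c : ∀ a v → c (u a ++ v) ≡ c (u 𝟎 ++ v)
      same-c 𝟎 v = refl
      same-c 𝟏 v = sym (proj₁ (same-pair v))

      same-r : ∀ a v v' → row (u a) v v' ≡ row (u 𝟎) v v'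
      same-r 𝟎 v v' = refl
      same-r 𝟏 v v' = sym (encode-injective {g = row (u 𝟎) v} {h = row (u 𝟏) v} (proj₂ (same-pair v)) v')

      -- If `c₀` is constant on the inner cube, then so are both the old colour and the sign of the
      -- edge in the new direction.
      c₀ : Word 2 N → Fin (t * 2)
      c₀ v = combine (c (u 𝟎 ++ v)) (r (u 𝟎 ++ v) (u 𝟏 ++ v))

      result : Σ (ParamWord 2 (suc d) (M + N)) λ p → Ordered p ×
        (∀ w w' → c (subst p w) ≡ c (subst p w')) ×
        Σ (Word 2 (suc d)) λ ε → ∀ w i → r (subst p (w [ i ]≔ 𝟎)) (subst p (w [ i ]≔ 𝟏)) ≡ lookup ε i
      result with proj₂ (direction-constant d (t * 2)) (row (u 𝟎)) c₀
      ... | q , q-ordered , c₀-const , ε , row-const =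
        p , ordered-join ℓ q ℓ-wildcard q-ordered , c-const , ε₀ ∷ ε , r-const
        where
        p = join ℓ q
        base = replicate d 𝟎
        ε₀ = r (u 𝟎 ++ subst q base) (u 𝟏 ++ subst q base)

        const : ∀ w w' → c (u 𝟎 ++ subst q w) ≡ c (u 𝟎 ++ subst q w') ×
                r (u 𝟎 ++ subst q w) (u 𝟏 ++ subst q w) ≡ r (u 𝟎 ++ subst q w') (u 𝟏 ++ subst q w')
        const w w' = Fin.combine-injective (c (u 𝟎 ++ subst q w)) _ (c (u 𝟎 ++ subst q w')) _ (c₀-const w w')

        c-const : ∀ w w' → c (subst p w) ≡ c (subst p w')
        c-const (a ∷ w) (a' ∷ w') = begin
          c (subst p (a ∷ w))      ≡⟨ cong c (subst-join ℓ q a w) ⟩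
          c (u a ++ subst q w)     ≡⟨ same-c a (subst q w) ⟩
          c (u 𝟎 ++ subst q w)     ≡⟨ proj₁ (const w w') ⟩
          c (u 𝟎 ++ subst q w')    ≡⟨ same-c a' (subst q w') ⟨
          c (u a' ++ subst q w')   ≡⟨ cong c (subst-join ℓ q a' w') ⟨
          c (subst p (a' ∷ w'))    ∎
          where open ≡-Reasoning

        r-const : ∀ w i → r (subst p (w [ i ]≔ 𝟎)) (subst p (w [ i ]≔ 𝟏)) ≡ lookup (ε₀ ∷ ε) i
        r-const (a ∷ w) zero = trans (cong₂ r (subst-join ℓ q 𝟎 w) (subst-join ℓ q 𝟏 w)) (proj₂ (const w base))
        -- Equality of the profiles moves the edge into the fibre over `u 𝟎`, where the recursive
        -- call fixes its sign.
        r-const (a ∷ w) (suc i) = trans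
          (cong₂ r (subst-join ℓ q a (w [ i ]≔ 𝟎)) (subst-join ℓ q a (w [ i ]≔ 𝟏)))
          (trans (same-r a _ _) (row-const w i))

-- Monotone subcubes

infix 4 _⊑_
_⊑_ : Word 2 n → Word 2 n → Set
u ⊑ v = ∀ i → lookup u i ≤ᶠ lookup v i

𝟎≤ : {a b : Fin 2} → a ≡ 𝟎 → a ≤ᶠ b
𝟎≤ refl = z≤n

≤𝟏 : {a b : Fin 2} → b ≡ 𝟏 → a ≤ᶠ b
≤𝟏 {a} refl = Fin.≤fromℕ a

Flips : Word 2 n → Fin 2 → Word 2 n → Word 2 n → Set
Flips ε σ v v' = ∀ i → lookup v i ≡ lookup v' i ⊎ (lookup v i ≡ 𝟎 × lookup v' i ≡ 𝟏 × lookup ε i ≡ σ)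

-- The letters are raised one at a time, the tail before the head, and each change is an edge of
-- sign `σ`. The relation `R` is arbitrary so that the recursion can absorb the fixed first letter
-- into it.
flips-path : (ε : Word 2 n) {σ : Fin 2} (R : Rel (Word 2 n) 0ℓ) → (∀ {v} → R v v) → Transitive R →
  (∀ w i → lookup ε i ≡ σ → R (w [ i ]≔ 𝟎) (w [ i ]≔ 𝟏)) →
  ∀ v v' → Flips ε σ v v' → R v v'
flips-path []      R rfl tr step []      []        _     = rfl
flips-path (e ∷ ε) R rfl tr step (x ∷ v) (x' ∷ v') flips = tr
  (flips-path ε (λ u u' → R (x ∷ u) (x ∷ u')) rfl tr (λ w i → step (x ∷ w) (suc i)) v v' (flips ∘ suc))
  first
  where
  first : R (x ∷ v') (x' ∷ v')
  first with flips zero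
  ... | inj₁ refl = rfl
  ... | inj₂ (refl , refl , eq) = step (𝟎 ∷ v') zero eq

Selects : Word 2 m → Fin 2 → ParamWord 2 d m → Set
Selects ε σ p = ∀ x {i} → lookup p x ≡ inj₂ i → lookup ε x ≡ σ

selects-flips : (ε : Word 2 m) {σ : Fin 2} (p : ParamWord 2 d m) → Selects ε σ p →
  {w w' : Word 2 d} → w ⊑ w' → Flips ε σ (subst p w) (subst p w')
selects-flips ε {σ} p sel {w} {w'} w⊑w' x rewrite lookup-subst p w x | lookup-subst p w' x
  with lookup p x in eq
... | inj₁ _ = inj₁ refl
... | inj₂ i = compare (lookup w i) (lookup w' i) (w⊑w' i)
  where
  compare : ∀ a a' → a ≤ᶠ a' → a ≡ a' ⊎ (a ≡ 𝟎 × a' ≡ 𝟏 × lookup ε x ≡ σ)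
  compare 𝟎 𝟎 _ = inj₁ refl
  compare 𝟎 𝟏 _ = inj₂ (refl , refl , sel x eq)
  compare 𝟏 𝟏 _ = inj₁ refl

Selection : Word 2 m → Fin 2 → ℕ → Set
Selection {m} ε σ d = Σ (ParamWord 2 d m) λ p → Ordered p × Selects ε σ p

skip : ∀ {ε : Word 2 m} {σ} e → Selection ε σ d → Selection (e ∷ ε) σ d
skip e (p , (param , prec) , sel) = inj₁ 𝟎 ∷ p ,
  ((λ i → let x , eq = param i in suc x , eq) ,
   (λ { zero _ () ; (suc y) i<j eq → let x , x<y , eq' = prec y i<j eq in suc x , s<s x<y , eq' })) ,
  (λ { zero () ; (suc x) eq → sel x eq })

take : ∀ {ε : Word 2 m} {σ} e → e ≡ σ → Selection ε σ d → Selection (e ∷ ε) σ (suc d)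
take {ε = ε} {σ} e refl (p , ord , sel) = inj₂ zero ∷ shift p ,
  ordered-extend (inj₂ zero ∷ shift p) p zero suc refl (λ _ → z<s) s<s (λ i → lookup-map i (map₂ suc) p) located ord ,
  sel'
  where
  located : ∀ x {i} → lookup (inj₂ zero ∷ shift p) x ≡ inj₂ (suc i) → ∃ λ x′ → x ≡ suc x′
  located (suc x) _ = x , refl

  sel' : Selects (e ∷ ε) σ (inj₂ zero ∷ shift p)
  sel' zero _ = refl
  sel' (suc x) eq with lookup p x in px | trans (sym (lookup-map x (map₂ suc) p)) eq
  ... | inj₂ i | _ = sel x px

nothing-selected : (ε : Word 2 m) (σ : Fin 2) → Selection ε σ 0
nothing-selected []      σ = [] , ((λ ()) , λ { {()} }) , λ ()
nothing-selected (e ∷ ε) σ = skip e (nothing-selected ε σ)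

-- Each sign either counts towards its own quota or is skipped by the other selection; an exhausted
-- quota ends the recursion.
select : ∀ a b (ε : Word 2 (a + b)) → Selection ε 𝟎 a ⊎ Selection ε 𝟏 b
select zero    b       ε = inj₁ (nothing-selected ε 𝟎)
select (suc a) zero    ε = inj₂ (nothing-selected ε 𝟏)
select (suc a) (suc b) (𝟎 ∷ ε) = [ inj₁ ∘ take 𝟎 refl , inj₂ ∘ skip 𝟎 ]′ (select a (suc b) ε)
select (suc a) (suc b) (𝟏 ∷ ε) rewrite ℕ.+-suc a b =
  [ inj₁ ∘ skip 𝟏 , inj₂ ∘ take 𝟏 refl ]′ (select (suc a) b ε)

monotone-subcube : ∀ a → ∃ λ n → (_≺_ : Rel (Word 2 n) 0ℓ) → IsStrictTotalOrder _≡_ _≺_ →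
  let open StrictToNonStrict _≡_ _≺_ using () renaming (_≤_ to _≼_) in
  Σ (ParamWord 2 a n) λ p → Ordered p ×
    ((∀ {w w'} → w ⊑ w' → subst p w ≼ subst p w') ⊎ (∀ {w w'} → w ⊑ w' → subst p w' ≼ subst p w))
monotone-subcube a = proj₁ (direction-constant (a + a) 1) , cube
  where
  N = proj₁ (direction-constant (a + a) 1)

  module _ (_≺_ : Rel (Word 2 N) 0ℓ) (sto : IsStrictTotalOrder _≡_ _≺_) where
    open IsStrictTotalOrder sto using (compare)
    open StrictToNonStrict _≡_ _≺_ using (isTotalOrder) renaming (_≤_ to _≼_)
    open IsTotalOrder (isTotalOrder sto) using () renaming (refl to ≼-refl; trans to ≼-trans)

    sign : ∀ {u v} → Tri (u ≺ v) (u ≡ v) (v ≺ u) → Fin 2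
    sign (tri< _ _ _) = 𝟎
    -- Equal words may receive either sign, since only the weak order is read off from it.
    sign (tri≈ _ _ _) = 𝟏
    sign (tri> _ _ _) = 𝟏

    sign-𝟎 : ∀ {u v} (c : Tri (u ≺ v) (u ≡ v) (v ≺ u)) → sign c ≡ 𝟎 → u ≼ v
    sign-𝟎 (tri< u≺v _ _) _ = inj₁ u≺v

    sign-𝟏 : ∀ {u v} (c : Tri (u ≺ v) (u ≡ v) (v ≺ u)) → sign c ≡ 𝟏 → v ≼ u
    sign-𝟏 (tri≈ _ u≡v _) _ = inj₂ (sym u≡v)
    sign-𝟏 (tri> _ _ v≺u) _ = inj₁ v≺u

    cube : Σ (ParamWord 2 a N) λ p → Ordered p ×
      ((∀ {w w'} → w ⊑ w' → subst p w ≼ subst p w') ⊎ (∀ {w w'} → w ⊑ w' → subst p w' ≼ subst p w))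
    -- At the outermost level the carried colouring is trivial, with a single colour. Of the `a + a`
    -- directions, some `a` share a sign.
    cube with proj₂ (direction-constant (a + a) 1) (λ u v → sign (compare u v)) (λ _ → zero)
    ... | q , q-ordered , _ , ε , const with select a a ε
    ...   | inj₁ (p , p-ordered , sel) = q ∘ₚ p , ordered-∘ₚ q p q-ordered p-ordered , inj₁ up
      where
      up : ∀ {w w'} → w ⊑ w' → subst (q ∘ₚ p) w ≼ subst (q ∘ₚ p) w'
      up {w} {w'} w⊑w' rewrite subst-∘ₚ q p w | subst-∘ₚ q p w' =
        flips-path ε (λ v v' → subst q v ≼ subst q v') ≼-refl ≼-trans
          (λ v i εi → sign-𝟎 (compare _ _) (trans (const v i) εi)) _ _ (selects-flips ε p sel w⊑w')
    ...   | inj₂ (p , p-ordered , sel) = q ∘ₚ p , ordered-∘ₚ q p q-ordered p-ordered , inj₂ down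
      where
      down : ∀ {w w'} → w ⊑ w' → subst (q ∘ₚ p) w' ≼ subst (q ∘ₚ p) w
      down {w} {w'} w⊑w' rewrite subst-∘ₚ q p w | subst-∘ₚ q p w' =
        flips-path ε (λ v v' → subst q v' ≼ subst q v) ≼-refl (flip ≼-trans)
          (λ v i εi → sign-𝟏 (compare _ _) (trans (const v i) εi)) _ _ (selects-flips ε p sel w⊑w')

-- Lexicographic subcubes of monotone orders

-- Each of these properties survives pullback along any map monotone for `⊑`, which lets the
-- recursion pass to the orders induced on a block.
record IsMonotonePreorder (_≼_ : Rel (Word 2 n) 0ℓ) : Set where
  field
    ≼-trans : Transitive _≼_
    ≼-total : Total _≼_
    _≼?_    : Decidable _≼_
    ⊑⇒≼     : ∀ {u v} → u ⊑ v → u ≼ v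

pullback : {_≼_ : Rel (Word 2 n) 0ℓ} (f : Word 2 m → Word 2 n) → (∀ {u v} → u ⊑ v → f u ⊑ f v) →
           IsMonotonePreorder _≼_ → IsMonotonePreorder (λ u v → f u ≼ f v)
pullback f f-mono M = record
  { ≼-trans = ≼-trans
  ; ≼-total = λ u v → ≼-total (f u) (f v)
  ; _≼?_    = λ u v → f u ≼? f v
  ; ⊑⇒≼     = ⊑⇒≼ ∘ f-mono
  }
  where open IsMonotonePreorder M

fill : Fin m → Vec A n → A → Vec A (m * n)
fill {m} {n = n} b v a = concat (replicate m (replicate n a) [ b ]≔ v)

lookup-fill : (b : Fin m) (v : Vec A n) (a : A) (i : Fin n) → lookup (fill b v a) (combine b i) ≡ lookup v i
lookup-fill {m} {n = n} b v a i = trans (lookup-concat (replicate m (replicate n a) [ b ]≔ v) b i)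
  (cong (λ u → lookup u i) (lookup∘update b (replicate m (replicate n a)) v))

lookup-fill-outside : {b b' : Fin m} → b' ≢ b → (v : Vec A n) (a : A) (i : Fin n) →
                      lookup (fill b v a) (combine b' i) ≡ a
lookup-fill-outside {m} {n = n} {b} {b'} b'≢b v a i = begin
  lookup (fill b v a) (combine b' i)              ≡⟨ lookup-concat (blocks [ b ]≔ v) b' i ⟩
  lookup (lookup (blocks [ b ]≔ v) b') i          ≡⟨ cong (λ u → lookup u i) (lookup∘update′ b'≢b blocks v) ⟩
  lookup (lookup blocks b') i                     ≡⟨ cong (λ u → lookup u i) (lookup-replicate b' (replicate n a)) ⟩
  lookup (replicate n a) i                        ≡⟨ lookup-replicate i a ⟩
  a                                               ∎
  where
  open ≡-Reasoning
  blocks = replicate m (replicate n a)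

map-fill : {B : Set} (f : A → B) (b : Fin m) (v : Vec A n) (a : A) → map f (fill b v a) ≡ fill b (map f v) (f a)
map-fill {m = m} {n = n} f b v a = begin
  map f (concat (replicate m (replicate n a) [ b ]≔ v))
    ≡⟨ map-concat f (replicate m (replicate n a) [ b ]≔ v) ⟩
  concat (map (map f) (replicate m (replicate n a) [ b ]≔ v))
    ≡⟨ cong concat (map-[]≔ (map f) (replicate m (replicate n a)) b) ⟩
  concat (map (map f) (replicate m (replicate n a)) [ b ]≔ map f v)
    ≡⟨ cong (λ bs → concat (bs [ b ]≔ map f v)) (map-replicate (map f) (replicate n a) m) ⟩
  concat (replicate m (map f (replicate n a)) [ b ]≔ map f v)
    ≡⟨ cong (λ c → concat (replicate m c [ b ]≔ map f v)) (map-replicate f a n) ⟩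
  fill b (map f v) (f a) ∎
  where open ≡-Reasoning

fill-⊑ : (b : Fin m) {u v : Word 2 n} (a : Fin 2) → u ⊑ v → fill b u a ⊑ fill b v a
fill-⊑ {m} {n} b {u} {v} a u⊑v x with Fin.combine-surjective {m} {n} x
... | b' , i , refl with b' Fin.≟ b
...   | yes refl = subst₂ _≤ᶠ_ (sym (lookup-fill b u a i)) (sym (lookup-fill b v a i)) (u⊑v i)
...   | no b'≢b = subst₂ _≤ᶠ_ (sym (lookup-fill-outside b'≢b u a i)) (sym (lookup-fill-outside b'≢b v a i)) Fin.≤-refl

-- Outside block `b` the left word is 0, and on block `b` the right word is 1.
fill-⊑-disjoint : {b b' : Fin m} → b ≢ b' → (u v : Word 2 n) → fill b u 𝟎 ⊑ fill b' v 𝟏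
fill-⊑-disjoint {m} {n} {b} {b'} b≢b' u v x with Fin.combine-surjective {m} {n} x
... | c , i , refl with c Fin.≟ b
...   | yes refl = ≤𝟏 (lookup-fill-outside b≢b' v 𝟏 i)
...   | no c≢b = 𝟎≤ (lookup-fill-outside c≢b u 𝟎 i)

∷-⊑ : {a b : Fin 2} {u v : Word 2 n} → a ≤ᶠ b → u ⊑ v → a ∷ u ⊑ b ∷ v
∷-⊑ a≤b u⊑v zero    = a≤b
∷-⊑ a≤b u⊑v (suc i) = u⊑v i

-- The extra leading coordinate makes the first wildcard precede the others even when `b` is the
-- first block.
enclose : Fin m → ParamWord 2 d n → ParamWord 2 (suc d) (suc (m * n))
enclose b q = inj₂ zero ∷ fill b (shift q) (inj₂ zero)

subst-enclose : (b : Fin m) (q : ParamWord 2 d n) (a : Fin 2) (w : Word 2 d) →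
                subst (enclose b q) (a ∷ w) ≡ a ∷ fill b (subst q w) a
subst-enclose b q a w = begin
  subst (enclose b q) (a ∷ w)                     ≡⟨ subst≡map (enclose b q) (a ∷ w) ⟩
  a ∷ map (letter (a ∷ w)) (fill b (shift q) _)   ≡⟨ cong (a ∷_) (map-fill (letter (a ∷ w)) b (shift q) _) ⟩
  a ∷ fill b (map (letter (a ∷ w)) (shift q)) a   ≡⟨ cong (λ v → a ∷ fill b v a) (trans (sym (subst≡map (shift q) (a ∷ w))) (subst-shift q a w)) ⟩
  a ∷ fill b (subst q w) a                        ∎
  where open ≡-Reasoning

ordered-enclose : (b : Fin m) (q : ParamWord 2 d n) → Ordered q → Ordered (enclose b q)
ordered-enclose {m} {d} {n} b q = ordered-extend (enclose b q) q zero (λ i → suc (combine b i)) refl (λ _ → z<s)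
  (λ {i} {j} i<j → s<s (subst₂ Data.Nat._<_ (sym (Fin.toℕ-combine b i)) (sym (Fin.toℕ-combine b j)) (ℕ.+-monoʳ-< (n * toℕ b) i<j)))
  (λ i → trans (lookup-fill b (shift q) _ i) (lookup-map i (map₂ suc) q)) located
  where
  located : ∀ x {i} → lookup (enclose b q) x ≡ inj₂ (suc i) → ∃ λ x′ → x ≡ suc (combine b x′)
  located (suc x) eq with Fin.combine-surjective {m} {n} x
  ... | b' , i , refl with b' Fin.≟ b
  ...   | yes refl = i , refl
  ...   | no b'≢b with trans (sym (lookup-fill-outside b'≢b (shift q) (inj₂ zero) i)) eq
  ...     | ()

-- Compares the largest word with first parameter 0 to the smallest with first parameter 1, in the
-- sense of `⊑`. In a monotone order this puts every word of the first kind below every word of the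
-- second.
Block≼Rest : Rel (Word 2 (suc (m * n))) 0ℓ → Fin m → Set
Block≼Rest {n = n} _≼_ b = (𝟎 ∷ fill b (replicate n 𝟏) 𝟎) ≼ (𝟏 ∷ fill b (replicate n 𝟎) 𝟏)

block≼rest? : {_≼_ : Rel (Word 2 (suc (m * n))) 0ℓ} → IsMonotonePreorder _≼_ →
              (b : Fin m) → Dec (Block≼Rest {m} {n} _≼_ b)
block≼rest? M b = IsMonotonePreorder._≼?_ M _ _

-- Two blocks cannot both exceed their complements, since each lies in the complement of the other.
block≼rest : (_≼_ : Fin s → Rel (Word 2 (suc (suc s * n))) 0ℓ) → (∀ j → IsMonotonePreorder (_≼_ j)) →
             ∃ λ b → ∀ j → Block≼Rest {suc s} {n} (_≼_ j) b
block≼rest {s} {n} _≼_ M with Fin.any? (λ b → Fin.all? (λ j → block≼rest? {suc s} {n} (M j) b))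
... | yes found = found
... | no none = contradiction below (proj₂ (bad b))
  where
  bad : ∀ b → ∃ λ j → ¬ Block≼Rest {suc s} {n} (_≼_ j) b
  bad b = Fin.¬∀⟶∃¬ s _ (λ j → block≼rest? {suc s} {n} (M j) b) (λ good → none (b , good))

  -- There are `suc s` blocks and `s` orders, so two blocks fail for the same order.
  collision = Fin.pigeonhole (ℕ.n<1+n s) (proj₁ ∘ bad)
  b  = proj₁ collision
  b' = proj₁ (proj₂ collision)
  b≢b' = Fin.<⇒≢ (proj₁ (proj₂ (proj₂ collision)))
  open IsMonotonePreorder (M (proj₁ (bad b)))

  ¬good' : ¬ Block≼Rest {suc s} {n} (_≼_ (proj₁ (bad b))) b'
  ¬good' = transport (λ j → ¬ Block≼Rest {suc s} {n} (_≼_ j) b') (sym (proj₂ (proj₂ (proj₂ collision)))) (proj₂ (bad b'))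

  below : Block≼Rest {suc s} {n} (_≼_ (proj₁ (bad b))) b
  below with ≼-total (𝟎 ∷ fill b' (replicate n 𝟏) 𝟎) (𝟏 ∷ fill b' (replicate n 𝟎) 𝟏)
  ... | inj₁ good' = contradiction good' ¬good'
  ... | inj₂ rest≼block = ≼-trans (⊑⇒≼ (∷-⊑ z≤n (fill-⊑-disjoint b≢b' _ _)))
    (≼-trans rest≼block (⊑⇒≼ (∷-⊑ z≤n (fill-⊑-disjoint (b≢b' ∘ sym) _ _))))

-- The number of orders doubles because both values of the first parameter induce an order on the
-- words in the block.
lex-subcube : ∀ d s → ∃ λ n →
  (_≼_ : Fin s → Rel (Word 2 n) 0ℓ) → (∀ j → IsMonotonePreorder (_≼_ j)) →
  Σ (ParamWord 2 d n) λ p → Ordered p × (∀ j w w' → Lex _<ᶠ_ w w' → restrict (_≼_ j) p w w')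
lex-subcube zero    s = zero , λ _ _ → [] , ((λ ()) , λ { {()} }) , λ { _ _ _ (() , _) }
-- One leading coordinate, and one block more than there are orders.
lex-subcube (suc d) s = suc (suc s * N) , cube
  where
  N = proj₁ (lex-subcube d (s + s))

  module _ (_≼_ : Fin s → Rel (Word 2 (suc (suc s * N))) 0ℓ) (M : ∀ j → IsMonotonePreorder (_≼_ j)) where
    b = proj₁ (block≼rest {n = N} _≼_ M)

    good : ∀ j → Block≼Rest {suc s} {N} (_≼_ j) b
    good = proj₂ (block≼rest {n = N} _≼_ M)

    Inner : Fin 2 → Fin s → Rel (Word 2 N) 0ℓ
    Inner a j u v = _≼_ j (a ∷ fill b u a) (a ∷ fill b v a)

    inner : Fin s ⊎ Fin s → Rel (Word 2 N) 0ℓ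
    inner = [ Inner 𝟎 , Inner 𝟏 ]′

    inner-monotone : ∀ j → IsMonotonePreorder (inner j)
    inner-monotone (inj₁ j) = pullback (λ u → 𝟎 ∷ fill b u 𝟎) (λ u⊑v → ∷-⊑ z≤n (fill-⊑ b 𝟎 u⊑v)) (M j)
    inner-monotone (inj₂ j) = pullback (λ u → 𝟏 ∷ fill b u 𝟏) (λ u⊑v → ∷-⊑ (s≤s z≤n) (fill-⊑ b 𝟏 u⊑v)) (M j)

    cube : Σ (ParamWord 2 (suc d) (suc (suc s * N))) λ p → Ordered p ×
           (∀ j w w' → Lex _<ᶠ_ w w' → restrict (_≼_ j) p w w')
    cube with proj₂ (lex-subcube d (s + s)) (inner ∘ splitAt s) (inner-monotone ∘ splitAt s)
    ... | q , q-ordered , q-lex = enclose b q , ordered-enclose b q q-ordered , lex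
      where
      inner-lex : ∀ a j w w' → Lex _<ᶠ_ w w' → Inner a j (subst q w) (subst q w')
      inner-lex 𝟎 j w w' w<w' = transport (λ j → inner j (subst q w) (subst q w')) (Fin.splitAt-↑ˡ s j s) (q-lex (j ↑ˡ s) w w' w<w')
      inner-lex 𝟏 j w w' w<w' = transport (λ j → inner j (subst q w) (subst q w')) (Fin.splitAt-↑ʳ s s j) (q-lex (s ↑ʳ j) w w' w<w')

      lex : ∀ j w w' → Lex _<ᶠ_ w w' → restrict (_≼_ j) (enclose b q) w w'
      lex j (a ∷ w) (a' ∷ w') lt rewrite subst-enclose b q a w | subst-enclose b q a' w' = step a a' lt
        where
        open IsMonotonePreorder (M j)
        step : ∀ a a' → Lex _<ᶠ_ (a ∷ w) (a' ∷ w') → _≼_ j (a ∷ fill b (subst q w) a) (a' ∷ fill b (subst q w') a')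
        -- Raise the block to all ones, cross by `good` to the empty block with first parameter 1,
        -- then raise the block to its target.
        step 𝟎 𝟏 (zero , _) = ≼-trans
          (⊑⇒≼ (∷-⊑ z≤n (fill-⊑ b 𝟎 λ i → ≤𝟏 (lookup-replicate i 𝟏))))
          (≼-trans (good j) (⊑⇒≼ (∷-⊑ (s≤s z≤n) (fill-⊑ b 𝟏 λ i → 𝟎≤ (lookup-replicate i 𝟎)))))
        step 𝟏 𝟏 (zero , _ , s<s ())
        -- The first letters agree, so the comparison takes place in the order that this letter
        -- induces on the block.
        step a a' (suc i , same , lt) with same zero z<s
        ... | refl = inner-lex a j w w' (i , (λ x x<i → same (suc x) (s<s x<i)) , lt)

-- Strict comparison and the choice of the ordering of the letters

lex-or-equal : (w w' : Word 2 d) → w ≡ w' ⊎ Lex _<ᶠ_ w w' ⊎ Lex _<ᶠ_ w' w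
lex-or-equal [] [] = inj₁ refl
lex-or-equal (a ∷ w) (a' ∷ w') with Fin.<-cmp a a'
... | tri< a<a' _ _ = inj₂ (inj₁ (zero , (λ _ ()) , a<a'))
... | tri> _ _ a>a' = inj₂ (inj₂ (zero , (λ _ ()) , a>a'))
... | tri≈ _ refl _ with lex-or-equal w w'
...   | inj₁ refl = inj₁ refl
...   | inj₂ (inj₁ (i , same , lt)) = inj₂ (inj₁ (suc i , (λ { zero _ → refl ; (suc x) (s<s x<i) → same x x<i }) , lt))
...   | inj₂ (inj₂ (i , same , lt)) = inj₂ (inj₂ (suc i , (λ { zero _ → refl ; (suc x) (s<s x<i) → same x x<i }) , lt))

-- Every wildcard occurs somewhere, and the corresponding letter can be read off there.
subst-injective : (p : ParamWord k d n) → IsParamWord p → ∀ {w w'} → subst p w ≡ subst p w' → lookup w ≗ lookup w'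
subst-injective p param {w} {w'} eq i with param i
... | x , px≡i = begin
  lookup w i                ≡⟨ cong (letter w) px≡i ⟨
  letter w (lookup p x)     ≡⟨ lookup-subst p w x ⟨
  lookup (subst p w) x      ≡⟨ cong (λ v → lookup v x) eq ⟩
  lookup (subst p w') x     ≡⟨ lookup-subst p w' x ⟩
  letter w' (lookup p x)    ≡⟨ cong (letter w') px≡i ⟩
  lookup w' i               ∎
  where open ≡-Reasoning

-- The case of a single order in `lex-subcube`. Injectivity of substitution makes the weak
-- comparison strict, and trichotomy of the lexicographic order then yields the converse
-- implication.
lex-subcube-of-monotone : ∀ d → ∃ λ a → ∀ {n} (_≺_ : Rel (Word 2 n) 0ℓ) → IsStrictTotalOrder _≡_ _≺_ →
  let open StrictToNonStrict _≡_ _≺_ using () renaming (_≤_ to _≼_) in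
  (q : ParamWord 2 a n) → Ordered q → (∀ {w w'} → w ⊑ w' → subst q w ≼ subst q w') →
  Σ (ParamWord 2 d n) λ p → Ordered p × (∀ w w' → restrict _≺_ p w w' ⇔ Lex _<ᶠ_ w w')
lex-subcube-of-monotone d = proj₁ (lex-subcube d 1) , cube
  where
  a = proj₁ (lex-subcube d 1)

  cube : ∀ {n} (_≺_ : Rel (Word 2 n) 0ℓ) → IsStrictTotalOrder _≡_ _≺_ →
    let open StrictToNonStrict _≡_ _≺_ using () renaming (_≤_ to _≼_) in
    (q : ParamWord 2 a n) → Ordered q → (∀ {w w'} → w ⊑ w' → subst q w ≼ subst q w') →
    Σ (ParamWord 2 d n) λ p → Ordered p × (∀ w w' → restrict _≺_ p w w' ⇔ Lex _<ᶠ_ w w')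
  cube _≺_ sto q q-ordered q-mono with proj₂ (lex-subcube d 1) (λ _ u v → subst q u ≼ subst q v) (λ _ → monotone)
    where
    open StrictToNonStrict _≡_ _≺_ using (isDecTotalOrder) renaming (_≤_ to _≼_)
    open IsDecTotalOrder (isDecTotalOrder sto) using (total; _≤?_) renaming (trans to ≼-trans)
    monotone : IsMonotonePreorder (λ u v → subst q u ≼ subst q v)
    monotone = record
      { ≼-trans = ≼-trans
      ; ≼-total = λ u v → total _ _
      ; _≼?_    = λ u v → _ ≤? _
      ; ⊑⇒≼     = q-mono
      }
  ... | p , p-ordered , p-lex = q ∘ₚ p , ordered , λ w w' → mk⇔ (≺⇒lex w w') (lex⇒≺ w w')
    where
    open IsStrictTotalOrder sto using (irrefl; asym)
    ordered = ordered-∘ₚ q p q-ordered p-ordered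

    lex⇒≺ : ∀ w w' → Lex _<ᶠ_ w w' → restrict _≺_ (q ∘ₚ p) w w'
    lex⇒≺ w w' lt with p-lex zero w w' lt
    ... | inj₁ pw≺pw' = subst₂ _≺_ (sym (subst-∘ₚ q p w)) (sym (subst-∘ₚ q p w')) pw≺pw'
    ... | inj₂ eq = contradiction
      (subst-injective (q ∘ₚ p) (proj₁ ordered) (trans (subst-∘ₚ q p w) (trans eq (sym (subst-∘ₚ q p w')))) (proj₁ lt))
      (Fin.<⇒≢ (proj₂ (proj₂ lt)))

    ≺⇒lex : ∀ w w' → restrict _≺_ (q ∘ₚ p) w w' → Lex _<ᶠ_ w w'
    ≺⇒lex w w' pw≺pw' with lex-or-equal w w'
    ... | inj₁ refl = contradiction pw≺pw' (irrefl refl)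
    ... | inj₂ (inj₁ lt) = lt
    ... | inj₂ (inj₂ gt) = contradiction pw≺pw' (asym (lex⇒≺ w' w gt))

lex-flip : (_<_ : Rel (Fin k) 0ℓ) (w w' : Word k d) → Lex _<_ w w' → Lex (flip _<_) w' w
lex-flip _<_ w w' (i , same , lt) = i , (λ j j<i → sym (same j j<i)) , lt

theorem3 : ∀ (d : ℕ) → 1 ≤ d → ∃ λ (n : ℕ) →
    ∀ (_≺_ : Rel (Word 2 n) 0ℓ) → IsStrictTotalOrder _≡_ _≺_ →
    Σ (ParamWord 2 d n) λ p → IsParamWord p × IsCanonical p ×
    Σ (Rel (Fin 2) 0ℓ) λ _<_ → IsStrictTotalOrder _≡_ _<_ ×
    (∀ (w w' : Word 2 d) → restrict _≺_ p w w' ⇔ Lex _<_ w w')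
theorem3 d _ = proj₁ (monotone-subcube a) , cube
  where
  a = proj₁ (lex-subcube-of-monotone d)

  cube : ∀ _≺_ → IsStrictTotalOrder _≡_ _≺_ →
    Σ (ParamWord 2 d _) λ p → IsParamWord p × IsCanonical p ×
    Σ (Rel (Fin 2) 0ℓ) λ _<_ → IsStrictTotalOrder _≡_ _<_ ×
    (∀ (w w' : Word 2 d) → restrict _≺_ p w w' ⇔ Lex _<_ w w')
  cube _≺_ sto with proj₂ (monotone-subcube a) _≺_ sto
  ... | q , q-ordered , inj₁ up
    with p , (param , prec) , lex ← proj₂ (lex-subcube-of-monotone d) _≺_ sto q q-ordered up =
    p , param , preceded⇒canonical p prec , _<ᶠ_ , Fin.<-isStrictTotalOrder , lex
  -- The reversed order is monotone on this subcube. Reversing its lexicographic restriction amounts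
  -- to reversing the order of the two letters.
  ... | q , q-ordered , inj₂ down
    with p , (param , prec) , lex ← proj₂ (lex-subcube-of-monotone d) (flip _≺_) (Flip.isStrictTotalOrder sto) q q-ordered
           (λ w⊑w' → [ inj₁ , inj₂ ∘ sym ]′ (down w⊑w')) =
    p , param , preceded⇒canonical p prec , flip _<ᶠ_ , Flip.isStrictTotalOrder Fin.<-isStrictTotalOrder ,
    λ w w' → mk⇔ (lex-flip _<ᶠ_ w' w ∘ Equivalence.to (lex w' w)) (Equivalence.from (lex w' w) ∘ lex-flip (flip _<ᶠ_) w w')
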